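{- Let $G$ be a connected graph of order $n \ge 3$. Then $\gamma_{\rm it}^{\rm g\prime}(G) \le \frac{5}{6}n$.
   Context: All graphs are finite and simple. For a vertex set $S$, $N_G(S)$ denotes the set of vertices adjacent to at least one vertex of $S$, and $G - X$ is the graph obtained by deleting the vertices of $X$. The total isolation game on a graph $G$ is played by two players, Dominator and Staller, who alternately select vertices of $G$. If $S$ is the set of vertices selected so far, a vertex $v$ may be selected only if $v$ is adjacent to some vertex $u$ such that either $u$ belongs to a component of $G - N_G(S)$ of order at least $2$, or $u \in S$ and $u$ is an isolated vertex of $G - N_G(S)$. The game ends when no such vertex exists. Dominator aims to minimize the total number of selected vertices, Staller aims to maximize it. $\gamma_{\rm it}^{\rm g\prime}(G)$ is the number of moves in the game in which Staller makes the first move and both players play optimally. -}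

module Defs where

open import Data.Nat using (ℕ; zero; suc; _≤_)
open import Data.Fin using (Fin)
open import Data.Fin.Subset using (Subset; _∈_; _∉_; _∪_; ⁅_⁆; ⊥)
open import Data.Bool using (Bool; true; false)
open import Data.Product using (Σ; ∃; _×_; _,_)
open import Data.Sum using (_⊎_)
open import Relation.Nullary using (¬_)
open import Relation.Binary.PropositionalEquality using (_≡_; _≢_)

record Graph (n : ℕ) : Set where
  field
    adj     : Fin n → Fin n → Bool
    symm    : ∀ u v → adj u v ≡ adj v u
    irrefl  : ∀ u → adj u u ≡ false

module _ {n : ℕ} (G : Graph n) where
  open Graph G

  Adj : Fin n → Fin n → Set
  Adj u v = adj u v ≡ true

  data Walk (u : Fin n) : Fin n → Set where
    here : Walk u u
    step : ∀ {x w} → Walk u x → Adj x w → Walk u w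

  Connected : Set
  Connected = ∀ u v → Walk u v

  InN : Subset n → Fin n → Set
  InN S w = ∃ λ s → s ∈ S × Adj s w

  InH : Subset n → Fin n → Set
  InH S w = ¬ InN S w

  data ReachH (S : Subset n) (u : Fin n) : Fin n → Set where
    start : InH S u → ReachH S u u
    extend : ∀ {x w} → ReachH S u x → Adj x w → InH S w → ReachH S u w

  InBigComponent : Subset n → Fin n → Set
  InBigComponent S u = ∃ λ w → w ≢ u × ReachH S u w

  IsolatedInH : Subset n → Fin n → Set
  IsolatedInH S u = InH S u × (∀ w → Adj u w → ¬ InH S w)

  Legal : Subset n → Fin n → Set
  Legal S v = ∃ λ u → Adj v u ×
                (InBigComponent S u ⊎ (u ∈ S × IsolatedInH S u))

  NoLegalMove : Subset n → Set
  NoLegalMove S = ∀ v → ¬ Legal S v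

  data Player : Set where
    dominator staller : Player

  other : Player → Player
  other dominator = staller
  other staller   = dominator

  -- Value k S p m : with fuel k, in position S with player p to move,
  -- the number of remaining moves under optimal play (Dominator minimises,
  -- Staller maximises) is m.  Each move selects a vertex not in S, so
  -- fuel n suffices from the empty position.
  Value : ℕ → Subset n → Player → ℕ → Set
  Value zero S p m = NoLegalMove S × m ≡ 0
  Value (suc k) S p m =
      (NoLegalMove S × m ≡ 0)
    ⊎ (∃ λ v → ∃ λ m' → Legal S v × Value k (S ∪ ⁅ v ⁆) (other p) m' × m ≡ suc m'
         × (∀ w m'' → Legal S w → Value k (S ∪ ⁅ w ⁆) (other p) m'' → Better p m' m''))
    where
      Better : Player → ℕ → ℕ → Set
      Better dominator a b = a ≤ b
      Better staller   a b = b ≤ a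

  GameValueStallerStart : ℕ → Set
  GameValueStallerStart m = Value n ⊥ staller m

{-# OPTIONS --safe #-}
module Submission where

-- Call an undominated vertex a target if it has been selected or has an undominated
-- neighbour; a move is legal exactly when it dominates a target, and no new targets arise.
-- Let t count the targets and c the selected undominated vertices, so c grows by at most
-- one per move. While some component of G - N(S) is nontrivial, Dominator can remove two
-- targets at once; afterwards all targets are selected, t = c, and at most t moves remain.
-- Hence 6m ≤ 5t + c with Dominator to move and 6m ≤ 5t + c + 2 with Staller to move.
-- From the start this misses 5n by 2, which Dominator recovers in the first reply: a
-- neighbour of Staller's vertex v that removes v and a further target leaves t ≤ n - 3
-- and c ≤ 1, and if there is none, then v is the only target left.

open import Defs
open import Data.Nat using (ℕ; zero; suc; _+_; _*_; _≤_; _<_; z≤n; s≤s; s≤s⁻¹)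
open import Data.Nat.Properties
  using (≤-refl; ≤-reflexive; ≤-trans; ≤-total; ≤-antisym; n≤1+n; n≮0; m≤m+n;
         +-monoˡ-≤; +-monoʳ-≤; *-monoʳ-≤; module ≤-Reasoning)
open import Data.Nat.Solver using (module +-*-Solver)
open import Data.Bool using (true)
open import Data.Bool.Properties using () renaming (_≟_ to _≟ᵇ_)
open import Data.Fin using (Fin; zero; suc)
open import Data.Fin.Properties using (_≟_; any?)
open import Data.Fin.Subset
  using (Subset; _∈_; _∉_; _⊆_; _∪_; _-_; ⁅_⁆; ⊥; ∣_∣; inside; outside)
open import Data.Fin.Subset.Properties
  using (_∈?_; ∉⊥; ∣p∣≤n; ∣⁅x⁆∣≡1; p⊆q⇒∣p∣≤∣q∣; x∈⁅x⁆; x∈⁅y⁆⇒x≡y; p⊆p∪q; q⊆p∪q;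
         x∈p∪q⁻; x∈p∪q⁺; ∪-identityʳ; x∈p∧x≢y⇒x∈p-y; x∈p⇒∣p-x∣<∣p∣)
open import Data.Vec using (tabulate; _∷_)
open import Data.Vec.Properties using (lookup∘tabulate; []=⇒lookup; lookup⇒[]=)
open import Data.Product using (∃; _×_; _,_; proj₁; proj₂; ∃₂)
open import Data.Sum using (_⊎_; inj₁; inj₂; [_,_]′; reduce)
open import Function using (_∘_; flip)
open import Relation.Binary.Definitions using (Total; Transitive)
open import Relation.Nullary using (¬_; Dec; yes; no; contradiction; does)
open import Relation.Nullary.Decidable
  using (_×-dec_; _⊎-dec_; ¬?; map′; dec-true; decidable-stable)
open import Relation.Unary using (Decidable)
open import Relation.Binary.PropositionalEquality
  using (_≡_; _≢_; refl; sym; trans; cong; subst)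

private
  variable
    n : ℕ

-- Finite subsets, their sizes, and optimal choices among finitely many options.

toSubset : {P : Fin n → Set} → Decidable P → Subset n
toSubset P? = tabulate (does ∘ P?)

∈-toSubset⁺ : {P : Fin n → Set} (P? : Decidable P) → ∀ {x} → P x → x ∈ toSubset P?
∈-toSubset⁺ P? {x} px =
  lookup⇒[]= x _ (trans (lookup∘tabulate (does ∘ P?) x) (dec-true (P? x) px))

∈-toSubset⁻ : {P : Fin n → Set} (P? : Decidable P) → ∀ {x} → x ∈ toSubset P? → P x
∈-toSubset⁻ P? {x} x∈ with P? x | trans (sym (lookup∘tabulate (does ∘ P?) x)) ([]=⇒lookup x∈)
... | yes px | _  = px
... | no _   | ()

∣p∪⁅x⁆∣≤1+∣p∣ : ∀ (p : Subset n) x → ∣ p ∪ ⁅ x ⁆ ∣ ≤ suc ∣ p ∣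
∣p∪⁅x⁆∣≤1+∣p∣ (inside  ∷ p) zero    rewrite ∪-identityʳ p = n≤1+n _
∣p∪⁅x⁆∣≤1+∣p∣ (outside ∷ p) zero    rewrite ∪-identityʳ p = ≤-refl
∣p∪⁅x⁆∣≤1+∣p∣ (inside  ∷ p) (suc x) = s≤s (∣p∪⁅x⁆∣≤1+∣p∣ p x)
∣p∪⁅x⁆∣≤1+∣p∣ (outside ∷ p) (suc x) = ∣p∪⁅x⁆∣≤1+∣p∣ p x

∣p∣<∣q∣ : ∀ {p q : Subset n} {x} → p ⊆ q → x ∈ q → x ∉ p → ∣ p ∣ < ∣ q ∣
∣p∣<∣q∣ {q = q} {x} p⊆q x∈q x∉p = ≤-trans
  (s≤s (p⊆q⇒∣p∣≤∣q∣ {q = q - x} λ z∈p → x∈p∧x≢y⇒x∈p-y (p⊆q z∈p) λ { refl → x∉p z∈p }))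
  (x∈p⇒∣p-x∣<∣p∣ x∈q)

2+∣p∣≤∣q∣ : ∀ {p q : Subset n} {x y} → p ⊆ q → x ≢ y → x ∈ q → y ∈ q → x ∉ p → y ∉ p →
            2 + ∣ p ∣ ≤ ∣ q ∣
2+∣p∣≤∣q∣ {q = q} {x} p⊆q x≢y x∈q y∈q x∉p y∉p = ≤-trans
  (s≤s (∣p∣<∣q∣ {q = q - x} (λ z∈p → x∈p∧x≢y⇒x∈p-y (p⊆q z∈p) λ { refl → x∉p z∈p })
                (x∈p∧x≢y⇒x∈p-y y∈q (x≢y ∘ sym)) y∉p))
  (x∈p⇒∣p-x∣<∣p∣ x∈q)

-- Induction on the number of options, comparing the first with the best of the rest. A general `R`
-- covers both players: `_≤_` gives Dominator's minimum, its flip Staller's maximum.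
none-or-optimal : {R : ℕ → ℕ → Set} → Total R → Transitive R → ∀ {n} {Q : Fin n → ℕ → Set} →
  (∀ i → Dec (∃ (Q i))) → (∀ {i a b} → Q i a → Q i b → a ≡ b) →
  (∀ i → ¬ ∃ (Q i)) ⊎ (∃₂ λ i a → Q i a × (∀ j b → Q j b → R a b))
none-or-optimal tot tr {zero} Q? fn = inj₁ λ ()
none-or-optimal {R} tot tr {suc n} {Q} Q? fn
  with Q? zero | none-or-optimal {R} tot tr {Q = Q ∘ suc} (Q? ∘ suc) fn
... | no ¬q₀ | inj₁ none = inj₁ λ { zero → ¬q₀ ; (suc i) → none i }
... | no ¬q₀ | inj₂ (i , a , q , opt) =
  inj₂ (suc i , a , q , λ { zero b q₀ → contradiction (b , q₀) ¬q₀ ; (suc j) → opt j })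
... | yes (a₀ , q₀) | inj₁ none =
  -- Reflexivity of `R` is extracted from totality by `reduce (tot a₀ a₀)`.
  inj₂ (zero , a₀ , q₀ , λ { zero b q → subst (R a₀) (fn q₀ q) (reduce (tot a₀ a₀))
                           ; (suc j) b q → contradiction (b , q) (none j) })
... | yes (a₀ , q₀) | inj₂ (i , a , q , opt) with tot a₀ a
...   | inj₁ a₀Ra = inj₂ (zero , a₀ , q₀ ,
          λ { zero b q′ → subst (R a₀) (fn q₀ q′) (reduce (tot a₀ a₀))
            ; (suc j) b q′ → tr a₀Ra (opt j b q′) })
...   | inj₂ aRa₀ = inj₂ (suc i , a , q ,
          λ { zero b q′ → subst (R a) (fn q₀ q′) aRa₀ ; (suc j) → opt j })

third-element : 3 ≤ n → (u v : Fin n) → ∃ λ z → z ≢ u × z ≢ v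
third-element (s≤s (s≤s (s≤s _))) zero          zero                = suc zero , (λ ()) , λ ()
third-element (s≤s (s≤s (s≤s _))) zero          (suc zero)          = suc (suc zero) , (λ ()) , λ ()
third-element (s≤s (s≤s (s≤s _))) zero          (suc (suc _))       = suc zero , (λ ()) , λ ()
third-element (s≤s (s≤s (s≤s _))) (suc zero)    zero                = suc (suc zero) , (λ ()) , λ ()
third-element (s≤s (s≤s (s≤s _))) (suc (suc _)) zero                = suc zero , (λ ()) , λ ()
third-element (s≤s (s≤s (s≤s _))) (suc _)       (suc _)             = zero , (λ ()) , λ ()

-- Domination, targets and legal moves.

module _ {n : ℕ} (G : Graph n) where
  open Graph G

  Adj-sym : ∀ {u v} → Adj G u v → Adj G v u
  Adj-sym {u} {v} = trans (symm v u)

  Adj⇒≢ : ∀ {u v} → Adj G u v → u ≢ v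
  Adj⇒≢ {u} uu refl with trans (sym uu) (irrefl u)
  ... | ()

  Adj? : ∀ u v → Dec (Adj G u v)
  Adj? u v = adj u v ≟ᵇ true

  InN? : ∀ S w → Dec (InN G S w)
  InN? S w = any? λ s → (s ∈? S) ×-dec Adj? s w

  InH? : ∀ S w → Dec (InH G S w)
  InH? S w = ¬? (InN? S w)

  InN-∪ : ∀ {S v w} → InN G S w → InN G (S ∪ ⁅ v ⁆) w
  InN-∪ (s , s∈S , sw) = s , p⊆p∪q _ s∈S , sw

  InH-∪⁻ : ∀ {S v w} → InH G (S ∪ ⁅ v ⁆) w → InH G S w
  InH-∪⁻ h = h ∘ InN-∪

  Adj⇒InN-∪ : ∀ {S v w} → Adj G v w → InN G (S ∪ ⁅ v ⁆) w
  Adj⇒InN-∪ {S} {v} vw = v , q⊆p∪q S _ (x∈⁅x⁆ v) , vw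

  ∈-∪⁅⁆⁻ : ∀ {S : Subset n} {v w} → w ∈ S ∪ ⁅ v ⁆ → w ∈ S ⊎ w ≡ v
  ∈-∪⁅⁆⁻ {S} {v} w∈ = [ inj₁ , inj₂ ∘ x∈⁅y⁆⇒x≡y v ]′ (x∈p∪q⁻ S _ w∈)

  -- A component of order at least 2 is recognised by one undominated neighbour, so reachability
  -- disappears and legality becomes decidable.
  Target : Subset n → Fin n → Set
  Target S u = InH G S u × (u ∈ S ⊎ ∃ λ w → Adj G u w × InH G S w)

  Exposed : Subset n → Fin n → Set
  Exposed S u = u ∈ S × InH G S u

  Target? : ∀ S → Decidable (Target S)
  Target? S u = InH? S u ×-dec (u ∈? S ⊎-dec any? λ w → Adj? u w ×-dec InH? S w)

  Exposed? : ∀ S → Decidable (Exposed S)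
  Exposed? S u = u ∈? S ×-dec InH? S u

  targets exposed : Subset n → Subset n
  targets S = toSubset (Target? S)
  exposed S = toSubset (Exposed? S)

  ReachH⇒InH : ∀ {S u w} → ReachH G S u w → InH G S u × InH G S w
  ReachH⇒InH (start h)      = h , h
  ReachH⇒InH (extend r _ h) = proj₁ (ReachH⇒InH r) , h

  -- The path is shortened from its far end until the predecessor is `u` itself; that step is the
  -- edge sought.
  ReachH⇒neighbour : ∀ {S u w} → w ≢ u → ReachH G S u w → ∃ λ x → Adj G u x × InH G S x
  ReachH⇒neighbour w≢u (start _) = contradiction refl w≢u
  ReachH⇒neighbour {u = u} w≢u (extend {x} r xw h) with x ≟ u
  ... | yes refl = _ , xw , h
  ... | no x≢u   = ReachH⇒neighbour x≢u r

  Legal⇒Target : ∀ {S v} → Legal G S v → ∃ λ u → Adj G v u × Target S u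
  Legal⇒Target (u , vu , inj₁ (w , w≢u , r)) =
    u , vu , proj₁ (ReachH⇒InH r) , inj₂ (ReachH⇒neighbour w≢u r)
  Legal⇒Target (u , vu , inj₂ (u∈S , h , _)) = u , vu , h , inj₁ u∈S

  Target⇒Legal : ∀ {S v u} → Adj G v u → Target S u → Legal G S v
  Target⇒Legal vu (h , inj₁ u∈S) =
    -- Isolation is automatic: a selected `u` dominates all its neighbours.
    _ , vu , inj₂ (u∈S , h , λ w uw h′ → h′ (_ , u∈S , uw))
  Target⇒Legal vu (h , inj₂ (w , uw , h′)) =
    _ , vu , inj₁ (w , Adj⇒≢ uw ∘ sym , extend (start h) uw h′)

  Legal? : ∀ S → Decidable (Legal G S)
  Legal? S v = map′ (λ (u , vu , t) → Target⇒Legal vu t) Legal⇒Target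
                    (any? λ u → Adj? v u ×-dec Target? S u)

  Target-∪⁻ : ∀ {S v u} → Legal G S v → Target (S ∪ ⁅ v ⁆) u → Target S u
  Target-∪⁻ legal (h , inj₂ (w , uw , h′)) = InH-∪⁻ h , inj₂ (w , uw , InH-∪⁻ h′)
  Target-∪⁻ legal (h , inj₁ u∈) with ∈-∪⁅⁆⁻ u∈
  ... | inj₁ u∈S  = InH-∪⁻ h , inj₁ u∈S
  -- Only `v` is newly selected, and legality gives it an undominated neighbour, so it was a target
  -- before.
  ... | inj₂ refl = let x , vx , hx , _ = Legal⇒Target legal in InH-∪⁻ h , inj₂ (x , vx , hx)

  Adj⇒¬Target-∪ : ∀ {S v u} → Adj G v u → ¬ Target (S ∪ ⁅ v ⁆) u
  Adj⇒¬Target-∪ vu (h , _) = h (Adj⇒InN-∪ vu)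

  -- Effect of a move on the numbers of targets and exposed vertices.

  targets-∪⊆ : ∀ {S v} → Legal G S v → targets (S ∪ ⁅ v ⁆) ⊆ targets S
  targets-∪⊆ {S} {v} legal =
    ∈-toSubset⁺ (Target? S) ∘ Target-∪⁻ legal ∘ ∈-toSubset⁻ (Target? (S ∪ ⁅ v ⁆))

  ∣targets-∪∣< : ∀ {S v} → Legal G S v → ∣ targets (S ∪ ⁅ v ⁆) ∣ < ∣ targets S ∣
  ∣targets-∪∣< {S} {v} legal = let u , vu , t = Legal⇒Target legal in
    ∣p∣<∣q∣ (targets-∪⊆ legal) (∈-toSubset⁺ (Target? S) t)
            (Adj⇒¬Target-∪ vu ∘ ∈-toSubset⁻ (Target? (S ∪ ⁅ v ⁆)))

  -- Adjacency to `x` makes the move legal; `y` may vanish either by being dominated or by losing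
  -- its last undominated neighbour while unselected.
  RemovesTwo : Subset n → Fin n → Set
  RemovesTwo S v = ∃₂ λ x y → x ≢ y × Target S x × Target S y ×
                     Adj G v x × ¬ Target (S ∪ ⁅ v ⁆) y

  RemovesTwo⇒Legal : ∀ {S v} → RemovesTwo S v → Legal G S v
  RemovesTwo⇒Legal (_ , _ , _ , tx , _ , vx , _) = Target⇒Legal vx tx

  2+∣targets-∪∣≤ : ∀ {S v} → RemovesTwo S v → 2 + ∣ targets (S ∪ ⁅ v ⁆) ∣ ≤ ∣ targets S ∣
  2+∣targets-∪∣≤ {S} {v} r@(x , y , x≢y , tx , ty , vx , ¬ty) =
    2+∣p∣≤∣q∣ (targets-∪⊆ (RemovesTwo⇒Legal r)) x≢y
              (∈-toSubset⁺ (Target? S) tx) (∈-toSubset⁺ (Target? S) ty)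
              (Adj⇒¬Target-∪ vx ∘ ∈-toSubset⁻ (Target? _)) (¬ty ∘ ∈-toSubset⁻ (Target? _))

  ∣exposed-∪∣≤ : ∀ S v → ∣ exposed (S ∪ ⁅ v ⁆) ∣ ≤ suc ∣ exposed S ∣
  ∣exposed-∪∣≤ S v = ≤-trans (p⊆q⇒∣p∣≤∣q∣ (sub ∘ ∈-toSubset⁻ (Exposed? (S ∪ ⁅ v ⁆))))
                             (∣p∪⁅x⁆∣≤1+∣p∣ (exposed S) v)
    where
    sub : ∀ {u} → Exposed (S ∪ ⁅ v ⁆) u → u ∈ exposed S ∪ ⁅ v ⁆
    sub (u∈ , h) with ∈-∪⁅⁆⁻ u∈
    ... | inj₁ u∈S  = x∈p∪q⁺ (inj₁ (∈-toSubset⁺ (Exposed? S) (u∈S , InH-∪⁻ h)))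
    ... | inj₂ refl = q⊆p∪q (exposed S) _ (x∈⁅x⁆ v)

  -- Edges of G - N(S) and the removal of two targets at once.

  Walk-exit : ∀ {P : Fin n → Set} → Decidable P → ∀ {u z} → Walk G u z → P u → ¬ P z →
              ∃₂ λ a v → P a × ¬ P v × Adj G a v
  Walk-exit P? here pu ¬pz = contradiction pu ¬pz
  Walk-exit P? (step {x} w xz) pu ¬pz with P? x
  ... | yes px = _ , _ , px , ¬pz , xz
  ... | no ¬px = Walk-exit P? w pu ¬px

  HEdge : Subset n → Set
  HEdge S = ∃₂ λ a b → Adj G a b × InH G S a × InH G S b

  HEdge? : ∀ S → Dec (HEdge S)
  HEdge? S = any? λ a → any? λ b → Adj? a b ×-dec InH? S a ×-dec InH? S b

  -- If no vertex sees two targets, then an edge ab of G - N(S) is a whole component of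
  -- it, and selecting any outside neighbour of a isolates the unselected vertex b.
  HEdge⇒RemovesTwo : 3 ≤ n → Connected G → ∀ {S} → HEdge S → ∃ (RemovesTwo S)
  HEdge⇒RemovesTwo 3≤n conn {S} (a , b , ab , ha , hb)
    with any? (λ v → any? λ x → any? λ y →
           ¬? (x ≟ y) ×-dec Target? S x ×-dec Target? S y ×-dec Adj? v x ×-dec Adj? v y)
  ... | yes (v , x , y , x≢y , tx , ty , vx , vy) =
    v , x , y , x≢y , tx , ty , vx , Adj⇒¬Target-∪ vy
  ... | no ¬two = let z , z≢a , z≢b = third-element 3≤n a b in
    exit (Walk-exit (λ x → x ≟ a ⊎-dec x ≟ b) (conn a z) (inj₁ refl) [ z≢a , z≢b ]′)
    where
    unique : ∀ {v x y} → Target S x → Target S y → Adj G v x → Adj G v y → x ≡ y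
    unique {v} {x} {y} tx ty vx vy = decidable-stable (x ≟ y) λ x≢y →
      ¬two (v , x , y , x≢y , tx , ty , vx , vy)

    isolate : ∀ {a b v} → Adj G a b → InH G S a → InH G S b → Adj G a v → v ≢ b →
              RemovesTwo S v
    isolate {a} {b} {v} ab ha hb av v≢b =
      a , b , Adj⇒≢ ab , ta , (hb , inj₂ (a , Adj-sym ab , ha)) , Adj-sym av , ¬tb
      where
      ta : Target S a
      ta = ha , inj₂ (b , ab , hb)
      ¬tb : ¬ Target (S ∪ ⁅ v ⁆) b
      ¬tb (_ , inj₁ b∈) with ∈-∪⁅⁆⁻ b∈
      ... | inj₁ b∈S = ha (b , b∈S , Adj-sym ab)
      ... | inj₂ b≡v = v≢b (sym b≡v)
      ¬tb (_ , inj₂ (w , bw , hw))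
        -- Such a `w` is a target next to `b`, as is `a`; hence `w` is `a`, which `v` dominates.
        with refl ← unique (InH-∪⁻ hw , inj₂ (b , Adj-sym bw , hb)) ta bw (Adj-sym ab)
        = hw (Adj⇒InN-∪ (Adj-sym av))

    exit : (∃₂ λ c v → (c ≡ a ⊎ c ≡ b) × ¬ (v ≡ a ⊎ v ≡ b) × Adj G c v) → ∃ (RemovesTwo S)
    exit (_ , v , inj₁ refl , v∉ , av) = v , isolate ab ha hb av (v∉ ∘ inj₂)
    exit (_ , v , inj₂ refl , v∉ , bv) = v , isolate (Adj-sym ab) hb ha bv (v∉ ∘ inj₁)

  ¬HEdge⇒targets⊆exposed : ∀ {S} → ¬ HEdge S → targets S ⊆ exposed S
  ¬HEdge⇒targets⊆exposed {S} ¬e = ∈-toSubset⁺ (Exposed? S) ∘ sub ∘ ∈-toSubset⁻ (Target? S)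
    where
    sub : ∀ {u} → Target S u → Exposed S u
    sub (h , inj₁ u∈S)           = u∈S , h
    sub (h , inj₂ (w , uw , h′)) = contradiction (_ , w , uw , h , h′) ¬e

  -- Uniqueness, existence and simple bounds of game values.

  Value-functional : ∀ k {S} p {a b} → Value G k S p a → Value G k S p b → a ≡ b
  Value-functional zero p (_ , refl) (_ , refl) = refl
  Value-functional (suc k) p (inj₁ (_ , refl)) (inj₁ (_ , refl)) = refl
  Value-functional (suc k) p (inj₁ (none , _)) (inj₂ (v , _ , legal , _)) =
    contradiction legal (none v)
  Value-functional (suc k) p (inj₂ (v , _ , legal , _)) (inj₁ (none , _)) =
    contradiction legal (none v)
  -- Each optimal move competes in the optimality clause of the other, so antisymmetry equates the
  -- values.
  Value-functional (suc k) dominator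
    (inj₂ (v , a , lv , va , refl , opt)) (inj₂ (w , b , lw , wb , refl , opt′)) =
    cong suc (≤-antisym (opt w b lw wb) (opt′ v a lv va))
  Value-functional (suc k) staller
    (inj₂ (v , a , lv , va , refl , opt)) (inj₂ (w , b , lw , wb , refl , opt′)) =
    cong suc (≤-antisym (opt′ v a lv va) (opt w b lw wb))

  -- Every legal move removes a target, so fuel equal to the number of targets suffices; with none
  -- left, no move is legal.
  Value-exists : ∀ k S p → ∣ targets S ∣ ≤ k → ∃ (Value G k S p)
  Value-exists zero S p t≤0 = 0 , (λ v lv → n≮0 (≤-trans (∣targets-∪∣< lv) t≤0)) , refl
  Value-exists (suc k) S p t≤ = choose p
    where
    Option : Player G → Fin n → ℕ → Set
    Option q v m = Legal G S v × Value G k (S ∪ ⁅ v ⁆) q m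

    reply : ∀ q {v} → Legal G S v → ∃ (Option q v)
    reply q {v} lv =
      let m , val = Value-exists k (S ∪ ⁅ v ⁆) q (s≤s⁻¹ (≤-trans (∣targets-∪∣< lv) t≤))
      in m , lv , val

    Option? : ∀ q v → Dec (∃ (Option q v))
    Option? q v = map′ (reply q) (proj₁ ∘ proj₂) (Legal? S v)

    stuck : ∀ q → (∀ v → ¬ ∃ (Option q v)) → NoLegalMove G S
    stuck q none v = none v ∘ reply q

    functional : ∀ q {v a b} → Option q v a → Option q v b → a ≡ b
    functional q (_ , va) (_ , vb) = Value-functional k q va vb

    choose : ∀ p → ∃ (Value G (suc k) S p)
    choose dominator
      with none-or-optimal ≤-total ≤-trans (Option? staller) (functional staller)
    ... | inj₁ none = 0 , inj₁ (stuck staller none , refl)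
    ... | inj₂ (v , m , (lv , val) , opt) =
      suc m , inj₂ (v , m , lv , val , refl , λ w m′ lw val′ → opt w m′ (lw , val′))
    choose staller
      with none-or-optimal {R = flip _≤_} (flip ≤-total) (flip ≤-trans)
             (Option? dominator) (functional dominator)
    ... | inj₁ none = 0 , inj₁ (stuck dominator none , refl)
    ... | inj₂ (v , m , (lv , val) , opt) =
      suc m , inj₂ (v , m , lv , val , refl , λ w m′ lw val′ → opt w m′ (lw , val′))

  Value≤∣targets∣ : ∀ k {S} p {m} → Value G k S p m → m ≤ ∣ targets S ∣
  Value≤∣targets∣ zero    p (_ , refl)        = z≤n
  Value≤∣targets∣ (suc k) p (inj₁ (_ , refl)) = z≤n
  Value≤∣targets∣ (suc k) p (inj₂ (v , m , lv , val , refl , _)) =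
    ≤-trans (s≤s (Value≤∣targets∣ k (other G p) val)) (∣targets-∪∣< lv)

  -- Any legal `v` bounds the optimum from above. The fuel hypothesis ensures that the position
  -- after `v` has a value to compare with.
  Value-dominator≤ : ∀ k {S m} → ∣ targets S ∣ ≤ suc k → Value G (suc k) S dominator m →
    ∀ {v} → Legal G S v → ∃ λ m′ → Value G k (S ∪ ⁅ v ⁆) staller m′ × m ≤ suc m′
  Value-dominator≤ k {S} t≤ (inj₁ (none , _)) lv = contradiction lv (none _)
  Value-dominator≤ k {S} t≤ (inj₂ (_ , _ , _ , _ , refl , opt)) {v} lv =
    let m′ , val = Value-exists k (S ∪ ⁅ v ⁆) staller (s≤s⁻¹ (≤-trans (∣targets-∪∣< lv) t≤))
    in m′ , val , s≤s (opt v m′ lv val)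

  -- The potential bound 5t + c.

  module _ (3≤n : 3 ≤ n) (conn : Connected G) where

    -- A move of Staller lowers 5t + c by at least 4, one of Dominator by at least 9.
    mutual
      dominator-bound : ∀ k {S m} → ∣ targets S ∣ ≤ k → Value G k S dominator m →
                        6 * m ≤ 5 * ∣ targets S ∣ + ∣ exposed S ∣
      dominator-bound zero t≤ (_ , refl) = z≤n
      dominator-bound (suc k) {S} {m} t≤ val with HEdge? S
      ... | no ¬e = begin
        6 * m                                ≤⟨ *-monoʳ-≤ 6 (Value≤∣targets∣ (suc k) dominator val) ⟩
        6 * t                                ≡⟨ solve 1 (λ t → con 6 :* t := con 5 :* t :+ t) refl t ⟩
        5 * t + t                            ≤⟨ +-monoʳ-≤ (5 * t) (p⊆q⇒∣p∣≤∣q∣ (¬HEdge⇒targets⊆exposed ¬e)) ⟩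
        5 * t + ∣ exposed S ∣                ∎
        where
        open ≤-Reasoning
        open +-*-Solver
        t = ∣ targets S ∣
      ... | yes e
        with v , two ← HEdge⇒RemovesTwo 3≤n conn e
        with m′ , val′ , m≤ ← Value-dominator≤ k t≤ val (RemovesTwo⇒Legal two) = begin
        6 * m                    ≤⟨ *-monoʳ-≤ 6 m≤ ⟩
        6 * suc m′               ≡⟨ solve 1 (λ m → con 6 :* (con 1 :+ m) := con 6 :+ con 6 :* m) refl m′ ⟩
        6 + 6 * m′               ≤⟨ +-monoʳ-≤ 6 (staller-bound k (s≤s⁻¹ (≤-trans (≤-trans (n≤1+n _) (2+∣targets-∪∣≤ two)) t≤)) val′) ⟩
        6 + (5 * t′ + c′ + 2)    ≤⟨ +-monoʳ-≤ 6 (+-monoˡ-≤ 2 (+-monoʳ-≤ (5 * t′) (∣exposed-∪∣≤ S v))) ⟩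
        -- One unit is to spare: the drop is at least 9, while 6 for the move and 2 for Staller's
        -- turn need only 8.
        6 + (5 * t′ + suc c + 2) ≤⟨ n≤1+n _ ⟩
        7 + (5 * t′ + suc c + 2) ≡⟨ solve 2 (λ t c → con 7 :+ (con 5 :* t :+ (con 1 :+ c) :+ con 2) := con 5 :* (con 2 :+ t) :+ c) refl t′ c ⟩
        5 * (2 + t′) + c         ≤⟨ +-monoˡ-≤ c (*-monoʳ-≤ 5 (2+∣targets-∪∣≤ two)) ⟩
        5 * ∣ targets S ∣ + c    ∎
        where
        open ≤-Reasoning
        open +-*-Solver
        t′ = ∣ targets (S ∪ ⁅ v ⁆) ∣
        c′ = ∣ exposed (S ∪ ⁅ v ⁆) ∣
        c  = ∣ exposed S ∣

      staller-bound : ∀ k {S m} → ∣ targets S ∣ ≤ k → Value G k S staller m →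
                      6 * m ≤ 5 * ∣ targets S ∣ + ∣ exposed S ∣ + 2
      staller-bound zero    t≤ (_ , refl)        = z≤n
      staller-bound (suc k) t≤ (inj₁ (_ , refl)) = z≤n
      staller-bound (suc k) {S} t≤ (inj₂ (v , m , lv , val , refl , _)) = begin
        6 * suc m                 ≡⟨ solve 1 (λ m → con 6 :* (con 1 :+ m) := con 6 :+ con 6 :* m) refl m ⟩
        6 + 6 * m                 ≤⟨ +-monoʳ-≤ 6 (dominator-bound k (s≤s⁻¹ (≤-trans (∣targets-∪∣< lv) t≤)) val) ⟩
        6 + (5 * t′ + c′)         ≤⟨ +-monoʳ-≤ 6 (+-monoʳ-≤ (5 * t′) (∣exposed-∪∣≤ S v)) ⟩
        -- Staller's move costs 6 but is only sure to lower the potential by 4; the constant 2 pays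
        -- the difference.
        6 + (5 * t′ + suc c)      ≡⟨ solve 2 (λ t c → con 6 :+ (con 5 :* t :+ (con 1 :+ c)) := con 5 :* (con 1 :+ t) :+ c :+ con 2) refl t′ c ⟩
        5 * suc t′ + c + 2        ≤⟨ +-monoˡ-≤ 2 (+-monoˡ-≤ c (*-monoʳ-≤ 5 (∣targets-∪∣< lv))) ⟩
        5 * ∣ targets S ∣ + c + 2 ∎
        where
        open ≤-Reasoning
        open +-*-Solver
        t′ = ∣ targets (S ∪ ⁅ v ⁆) ∣
        c′ = ∣ exposed (S ∪ ⁅ v ⁆) ∣
        c  = ∣ exposed S ∣

    -- Staller's first move and Dominator's reply.

    module FirstMove (v : Fin n) where
      S₁ : Subset n
      S₁ = ⊥ ∪ ⁅ v ⁆

      InN-S₁⁻ : ∀ {w} → InN G S₁ w → Adj G v w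
      InN-S₁⁻ (s , s∈ , sw) with ∈-∪⁅⁆⁻ s∈
      ... | inj₁ s∈⊥  = contradiction s∈⊥ ∉⊥
      ... | inj₂ refl = sw

      v-Target : ∀ {x} → Adj G v x → Target S₁ v
      v-Target vx = (λ i → Adj⇒≢ (InN-S₁⁻ i) refl) , inj₁ (q⊆p∪q ⊥ _ (x∈⁅x⁆ v))

      Reply : Set
      Reply = ∃₂ λ x y → Adj G v x × Adj G x y × y ≢ v × Target S₁ y

      Reply? : Dec Reply
      Reply? = any? λ x → any? λ y →
        Adj? v x ×-dec Adj? x y ×-dec ¬? (y ≟ v) ×-dec Target? S₁ y

      -- Of the two selected vertices, `v` is dominated by `x`, so only `x` can be exposed.
      ∣exposed∣≤1 : ∀ {x} → Adj G v x → ∣ exposed (S₁ ∪ ⁅ x ⁆) ∣ ≤ 1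
      ∣exposed∣≤1 {x} vx = ≤-trans
        (p⊆q⇒∣p∣≤∣q∣ (sub ∘ ∈-toSubset⁻ (Exposed? (S₁ ∪ ⁅ x ⁆)))) (≤-reflexive (∣⁅x⁆∣≡1 x))
        where
        sub : ∀ {u} → Exposed (S₁ ∪ ⁅ x ⁆) u → u ∈ ⁅ x ⁆
        sub (u∈ , h) with ∈-∪⁅⁆⁻ u∈
        ... | inj₂ refl = x∈⁅x⁆ x
        ... | inj₁ u∈S₁ with ∈-∪⁅⁆⁻ u∈S₁
        ...   | inj₁ u∈⊥  = contradiction u∈⊥ ∉⊥
        ...   | inj₂ refl = contradiction (Adj⇒InN-∪ (Adj-sym vx)) h

      -- Without a reply, every vertex at distance two from v is isolated in G - N(v), so
      -- there is no vertex at distance three.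
      Near : Fin n → Set
      Near w = w ≡ v ⊎ Adj G v w ⊎ ∃ λ x → Adj G v x × Adj G x w

      near : ¬ Reply → ∀ {w} → Walk G v w → Near w
      near ¬r here = inj₁ refl
      near ¬r (step {z} {w} walk zw) with near ¬r walk
      ... | inj₁ refl      = inj₂ (inj₁ zw)
      ... | inj₂ (inj₁ vz) = inj₂ (inj₂ (z , vz , zw))
      ... | inj₂ (inj₂ (x , vx , xz)) with z ≟ v | Adj? v z | Adj? v w
      ...   | yes refl | _      | _      = inj₂ (inj₁ zw)
      ...   | no _     | yes vz | _      = inj₂ (inj₂ (z , vz , zw))
      ...   | no _     | no _   | yes vw = inj₂ (inj₁ vw)
      -- Here `z` and `w` are adjacent and both undominated, so `z` is a target and `x` with `z`
      -- forms a reply.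
      ...   | no z≢v   | no ¬vz | no ¬vw = contradiction
        (x , z , vx , xz , z≢v , ¬vz ∘ InN-S₁⁻ , inj₂ (w , zw , ¬vw ∘ InN-S₁⁻)) ¬r

      ∣targets∣≤1 : ¬ Reply → ∣ targets S₁ ∣ ≤ 1
      ∣targets∣≤1 ¬r = ≤-trans
        (p⊆q⇒∣p∣≤∣q∣ λ {u} u∈ → sub (near ¬r (conn v u)) (∈-toSubset⁻ (Target? S₁) u∈))
        (≤-reflexive (∣⁅x⁆∣≡1 v))
        where
        sub : ∀ {u} → Near u → Target S₁ u → u ∈ ⁅ v ⁆
        sub (inj₁ refl) _ = x∈⁅x⁆ v
        sub (inj₂ (inj₁ vu)) t = contradiction t (Adj⇒¬Target-∪ vu)
        sub {u} (inj₂ (inj₂ (x , vx , xu))) t with u ≟ v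
        ... | yes refl = x∈⁅x⁆ v
        ... | no u≢v   = contradiction (x , u , vx , xu , u≢v , t) ¬r

      Reply⇒RemovesTwo : (r : Reply) → RemovesTwo S₁ (proj₁ r)
      Reply⇒RemovesTwo (x , y , vx , xy , y≢v , ty) =
        v , y , y≢v ∘ sym , v-Target vx , ty , Adj-sym vx , Adj⇒¬Target-∪ xy

    first-move-bound : ∀ k {v m} → n ≡ 2 + k → Legal G ⊥ v →
      Value G (suc k) (⊥ ∪ ⁅ v ⁆) dominator m → 6 * suc m ≤ 5 * n
    first-move-bound k {v} {m} n≡ lv val with FirstMove.Reply? v
    -- At most one move follows Staller's, and 6 * 2 = 12 ≤ 15 ≤ 5n.
    ... | no ¬r = ≤-trans
      (*-monoʳ-≤ 6 (s≤s (≤-trans (Value≤∣targets∣ (suc k) dominator val) (∣targets∣≤1 ¬r))))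
      (≤-trans (m≤m+n 12 3) (*-monoʳ-≤ 5 3≤n))
      where open FirstMove v
    ... | yes r@(x , _ , vx , _)
      with two ← FirstMove.Reply⇒RemovesTwo v r
      with m′ , val′ , m≤ ← Value-dominator≤ k
             (s≤s⁻¹ (≤-trans (∣targets-∪∣< lv) (≤-trans (∣p∣≤n (targets ⊥)) (≤-reflexive n≡))))
             val (RemovesTwo⇒Legal two) = begin
      6 * suc m                  ≤⟨ *-monoʳ-≤ 6 (s≤s m≤) ⟩
      6 * (2 + m′)               ≡⟨ solve 1 (λ m → con 6 :* (con 2 :+ m) := con 12 :+ con 6 :* m) refl m′ ⟩
      12 + 6 * m′                ≤⟨ +-monoʳ-≤ 12 (staller-bound k t₂≤k val′) ⟩
      12 + (5 * t₂ + c₂ + 2)     ≤⟨ +-monoʳ-≤ 12 (+-monoˡ-≤ 2 (+-monoʳ-≤ (5 * t₂) (∣exposed∣≤1 vx))) ⟩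
      -- Two moves cost 12, the exposed vertex 1 and Staller's turn 2: exactly 5 for each of the
      -- three targets already removed.
      12 + (5 * t₂ + 1 + 2)      ≡⟨ solve 1 (λ t → con 12 :+ (con 5 :* t :+ con 1 :+ con 2) := con 5 :* (con 3 :+ t)) refl t₂ ⟩
      5 * (3 + t₂)               ≤⟨ *-monoʳ-≤ 5 3+t₂≤n ⟩
      5 * n                      ∎
      where
      open FirstMove v
      open ≤-Reasoning
      open +-*-Solver
      t₂ = ∣ targets (S₁ ∪ ⁅ x ⁆) ∣
      c₂ = ∣ exposed (S₁ ∪ ⁅ x ⁆) ∣
      3+t₂≤n : 3 + t₂ ≤ n
      3+t₂≤n = ≤-trans (s≤s (2+∣targets-∪∣≤ two)) (≤-trans (∣targets-∪∣< lv) (∣p∣≤n (targets ⊥)))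
      t₂≤k : t₂ ≤ k
      t₂≤k = ≤-trans (n≤1+n _) (s≤s⁻¹ (s≤s⁻¹ (≤-trans 3+t₂≤n (≤-reflexive n≡))))

    Value-staller-start≤ : ∀ k {m} → n ≡ 2 + k → Value G (2 + k) ⊥ staller m → 6 * m ≤ 5 * n
    Value-staller-start≤ k n≡ (inj₁ (_ , refl))                    = z≤n
    Value-staller-start≤ k n≡ (inj₂ (_ , _ , lv , val , refl , _)) = first-move-bound k n≡ lv val

theorem4p2 : ∀ (n : ℕ) (G : Graph n) → 3 ≤ n → Connected G →
    ∃ λ m → GameValueStallerStart G m × 6 * m ≤ 5 * n
theorem4p2 n@(suc (suc k)) G 3≤n conn =
  let m , val = Value-exists G n ⊥ staller (∣p∣≤n (targets G ⊥))
  in m , val , Value-staller-start≤ G 3≤n conn k refl val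
theorem4p2 (suc zero) G (s≤s ()) conn
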